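{- The number of unique configurations of length $n$ is $\Omega(2^n)$.
   Context: For a real sequence $A=(a_1,\dots,a_n)$, a configuration is a sequence $P=(p_1,\dots,p_n)$ with $p_\ell\in\{1,\dots,n-\ell+1\}$ for each $\ell$; $P$ is an output configuration for $A$ if for every $\ell=1,\dots,n$ the sum $a_{p_\ell}+\dots+a_{p_\ell+\ell-1}$ is maximum among all sums of $\ell$ consecutive entries of $A$. A configuration $P$ is unique if there exists $A\in\mathbb{R}^n$ whose only output configuration is $P$. -}

module Defs where

open import Algebra.Bundles using (module CommutativeMonoid)
open import Data.Fin using (Fin; toℕ; fromℕ<)
open import Data.Fin.Properties using (toℕ<n; toℕ≤pred[n]; injective⇒≤)
open import Data.Integer using (+_)
open import Data.Nat as ℕ using (ℕ; suc; _∸_)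
import Data.Nat.Properties as ℕ
open import Data.Product using (Σ; ∃; _×_; _,_; proj₁; proj₂)
open import Data.Rational as ℚ using (ℚ; 0ℚ; ½; ∣_∣)
import Data.Rational.Properties as ℚ
open import Algebra.Properties.CommutativeSemigroup
  (CommutativeMonoid.commutativeSemigroup ℚ.+-0-commutativeMonoid)
  using (interchange)
open import Data.Vec.Functional using (Vector; foldr)
open import Function.Definitions using (Injective)
open import Relation.Binary.PropositionalEquality
  using (_≡_; sym; trans; cong; subst)

IsCauchy : (ℕ → ℚ) → Set
IsCauchy x = ∀ ε → 0ℚ ℚ.< ε →
  ∃ λ N → ∀ m n → m ℕ.≥ N → n ℕ.≥ N → ∣ x m ℚ.- x n ∣ ℚ.< ε

record ℝ : Set where
  constructor mkℝ
  field
    seq    : ℕ → ℚ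
    cauchy : IsCauchy seq

open ℝ public

-- lim x ≤ lim y.  Distinct sequences may represent the same real, so the
-- equality of reals is x ≤ℝ y together with y ≤ℝ x.
_≤ℝ_ : ℝ → ℝ → Set
x ≤ℝ y = ∀ ε → 0ℚ ℚ.< ε →
  ∃ λ N → ∀ n → n ℕ.≥ N → seq x n ℚ.≤ seq y n ℚ.+ ε

infix 4 _≤ℝ_

fromℚ : ℚ → ℝ
fromℚ q = mkℝ (λ _ → q) λ ε 0<ε →
  0 , λ _ _ _ _ → subst (ℚ._< ε) (sym (cong ∣_∣ (ℚ.+-inverseʳ q))) 0<ε

0ℝ : ℝ
0ℝ = fromℚ 0ℚ

private
  halves : ∀ ε → ½ ℚ.* ε ℚ.+ ½ ℚ.* ε ≡ ε
  halves ε = trans (sym (ℚ.*-distribʳ-+ ε ½ ½)) (ℚ.*-identityˡ ε)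

  half-pos : ∀ ε → 0ℚ ℚ.< ε → 0ℚ ℚ.< ½ ℚ.* ε
  half-pos ε 0<ε = subst (ℚ._< ½ ℚ.* ε) (ℚ.*-zeroʳ ½) (ℚ.*-monoʳ-<-pos ½ 0<ε)

  +-minus-interchange : ∀ a b c d →
    (a ℚ.+ b) ℚ.- (c ℚ.+ d) ≡ (a ℚ.- c) ℚ.+ (b ℚ.- d)
  +-minus-interchange a b c d = trans
    (cong ((a ℚ.+ b) ℚ.+_) (ℚ.neg-distrib-+ c d))
    (interchange a b (ℚ.- c) (ℚ.- d))

_+ℝ_ : ℝ → ℝ → ℝ
seq    (x +ℝ y) n = seq x n ℚ.+ seq y n
cauchy (x +ℝ y) ε 0<ε
  with M , x-close ← cauchy x (½ ℚ.* ε) (half-pos ε 0<ε)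
     | N , y-close ← cauchy y (½ ℚ.* ε) (half-pos ε 0<ε)
  = M ℕ.⊔ N , λ m n m≥ n≥ → begin-strict
    ∣ (seq x m ℚ.+ seq y m) ℚ.- (seq x n ℚ.+ seq y n) ∣
      ≡⟨ cong ∣_∣ (+-minus-interchange (seq x m) (seq y m) (seq x n) (seq y n)) ⟩
    ∣ (seq x m ℚ.- seq x n) ℚ.+ (seq y m ℚ.- seq y n) ∣
      ≤⟨ ℚ.∣p+q∣≤∣p∣+∣q∣ (seq x m ℚ.- seq x n) (seq y m ℚ.- seq y n) ⟩
    ∣ seq x m ℚ.- seq x n ∣ ℚ.+ ∣ seq y m ℚ.- seq y n ∣
      <⟨ ℚ.+-mono-<
           (x-close m n (ℕ.m⊔n≤o⇒m≤o M N m≥) (ℕ.m⊔n≤o⇒m≤o M N n≥))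
           (y-close m n (ℕ.m⊔n≤o⇒n≤o M N m≥) (ℕ.m⊔n≤o⇒n≤o M N n≥)) ⟩
    ½ ℚ.* ε ℚ.+ ½ ℚ.* ε
      ≡⟨ halves ε ⟩
    ε ∎
  where open ℚ.≤-Reasoning

infixl 6 _+ℝ_

-- Lengths and positions are both shifted down by one: the index ℓ : Fin n
-- stands for the window length toℕ ℓ + 1, and P ℓ is the zero-based start of
-- the window, so that it ranges over n - (toℕ ℓ + 1) + 1 = n ∸ toℕ ℓ values.
Config : ℕ → Set
Config n = (ℓ : Fin n) → Fin (n ∸ toℕ ℓ)

_≈_ : ∀ {n} → Config n → Config n → Set
P ≈ Q = ∀ ℓ → P ℓ ≡ Q ℓ

infix 4 _≈_

windowIndex : ∀ {n} (ℓ : Fin n) → Fin (n ∸ toℕ ℓ) → Fin (suc (toℕ ℓ)) → Fin n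
windowIndex {n} ℓ p j = fromℕ< {toℕ p ℕ.+ toℕ j} (ℕ.≤-trans
  (ℕ.+-monoʳ-≤ (suc (toℕ p)) (toℕ≤pred[n] j))
  (ℕ.m≤o∸n⇒m+n≤o (suc (toℕ p)) (ℕ.<⇒≤ (toℕ<n ℓ)) (toℕ<n p)))

windowSum : ∀ {n} → Vector ℝ n → (ℓ : Fin n) → Fin (n ∸ toℕ ℓ) → ℝ
windowSum A ℓ p = foldr _+ℝ_ 0ℝ (λ j → A (windowIndex ℓ p j))

IsOutput : ∀ {n} → Vector ℝ n → Config n → Set
IsOutput A P = ∀ ℓ q → windowSum A ℓ q ≤ℝ windowSum A ℓ (P ℓ)

IsUnique : ∀ {n} → Config n → Set
IsUnique {n} P = Σ (Vector ℝ n) λ A →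
  IsOutput A P × (∀ Q → IsOutput A Q → Q ≈ P)

HasAtLeast : ∀ {n} → ℕ → (Config n → Set) → Set
HasAtLeast {n} m S = Σ (Fin m → Config n) λ f →
  Injective _≡_ _≈_ f × (∀ i → S (f i))

HasExactly : ∀ {n} → ℕ → (Config n → Set) → Set
HasExactly {n} k S = Σ (Fin k → Config n) λ f →
  Injective _≡_ _≈_ f × (∀ i → S (f i)) × (∀ P → S P → ∃ λ i → f i ≈ P)

-- An exact count of an undecided predicate need not be available
-- constructively; HasAtLeast is the lower bound on that count whenever
-- there is one.
HasAtLeast⇒≤ : ∀ {n m k} {S : Config n → Set} →
  HasAtLeast m S → HasExactly k S → m ℕ.≤ k
HasAtLeast⇒≤ (f , f-inj , f∈S) (g , _ , _ , g-onto) =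
  injective⇒≤ {f = λ i → proj₁ (g-onto (f i) (f∈S i))} λ {i} {j} eq →
    f-inj λ ℓ → trans
      (sym (proj₂ (g-onto (f i) (f∈S i)) ℓ))
      (trans (cong (λ h → g h ℓ) eq) (proj₂ (g-onto (f j) (f∈S j)) ℓ))

ℕ→ℚ : ℕ → ℚ
ℕ→ℚ m = + m ℚ./ 1

-- A positive real constant can always be lowered to a positive rational one.
Count_∈Ω_ : (∀ {n} → Config n → Set) → (ℕ → ℕ) → Set
Count S ∈Ω g = ∃ λ c → 0ℚ ℚ.< c × ∃ λ N → ∀ n → n ℕ.≥ N →
  ∃ λ m → c ℚ.* ℕ→ℚ (g n) ℚ.≤ ℕ→ℚ m × HasAtLeast {n} m S

module Submission where

open import Defs
open import Data.Nat using (_^_)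

open import Algebra.Bundles using (module CommutativeMonoid)
open import Data.Bool using (if_then_else_; true; false)
open import Data.Fin using (Fin; zero; suc; toℕ; fromℕ<; quotient; remainder; combine)
import Data.Fin.Properties as Fin
open import Data.Integer as ℤ using (+_)
import Data.Integer.Properties as ℤ
open import Data.Nat as ℕ using (ℕ; zero; suc; _∸_; _≤?_; z≤n; s≤s)
import Data.Nat.Properties as ℕ
open import Data.Product using (_,_)
open import Data.Rational as ℚ using (ℚ; 0ℚ; 1ℚ; ½; toℚᵘ)
import Data.Rational.Properties as ℚ
open import Data.Rational.Unnormalised as ℚᵘ using (mkℚᵘ; *≡*)
import Data.Rational.Unnormalised.Properties as ℚᵘ
open import Data.Vec using (Vec; []; _∷_)
open import Data.Vec.Functional using (Vector; foldr)
open import Data.Vec.Properties using (∷-injectiveˡ; ∷-injectiveʳ)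
open import Function using (_∘_)
open import Relation.Binary.PropositionalEquality
open import Relation.Nullary using (yes; no; does; contradiction)
open import Relation.Nullary.Decidable using (dec-true; dec-false; from-yes)

open import Algebra.Properties.Monoid.Sum
  (CommutativeMonoid.monoid ℚ.+-0-commutativeMonoid)
  using (sum; sum-cong-≗; sum-init-last)

-- Insert strictly decreasing values one at a time at the right end (bit 0) or
-- the left end (bit 1) of the sequence.  The ℓ largest values then always form
-- a window, which is the only optimal one of its length.  Each insertion on the
-- left moves the earlier windows by one, so the 2ⁿ bit vectors give 2ⁿ distinct
-- unique configurations of length n + 1.

level : ℕ → ℚ
level zero    = 0ℚ
level (suc n) = level n ℚ.- 1ℚ

level-decreasing : ∀ n → level (suc n) ℚ.< level n
level-decreasing n = subst (level (suc n) ℚ.<_) (ℚ.+-identityʳ (level n))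
  (ℚ.+-monoʳ-< (level n) (from-yes (ℚ.- 1ℚ ℚ.<? 0ℚ)))

-- The head of the vector is the last insertion.  Only the values at 0, …, n
-- matter.
entry : ∀ {n} → Vec (Fin 2) n → ℕ → ℚ
entry             []               i       = level 0
entry {n = suc n} (zero     ∷ bs)  i       =
  if does (i ≤? n) then entry bs i else level (suc n)
entry {n = suc n} (suc zero ∷ bs)  zero    = level (suc n)
entry             (suc zero ∷ bs)  (suc i) = entry bs i

-- Every value, even one past the right end, is among `level 0`, ..., `level n`.
level≤entry : ∀ {n} (bs : Vec (Fin 2) n) i → level n ℚ.≤ entry bs i
level≤entry             []              i = ℚ.≤-refl
level≤entry {n = suc n} (zero ∷ bs)     i with does (i ≤? n)
... | true  = ℚ.≤-trans (ℚ.<⇒≤ (level-decreasing n)) (level≤entry bs i)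
... | false = ℚ.≤-refl
level≤entry             (suc zero ∷ bs) zero    = ℚ.≤-refl
level≤entry {n = suc n} (suc zero ∷ bs) (suc i) =
  ℚ.≤-trans (ℚ.<⇒≤ (level-decreasing n)) (level≤entry bs i)

-- Here `level (suc n)` is the next value to be inserted: exchanging it for any older entry raises a
-- sum.
level<entry : ∀ {n} (bs : Vec (Fin 2) n) i → level (suc n) ℚ.< entry bs i
level<entry {n} bs i = ℚ.<-≤-trans (level-decreasing n) (level≤entry bs i)

entry-old : ∀ {n} (bs : Vec (Fin 2) n) {i} → i ℕ.≤ n →
  entry (zero ∷ bs) i ≡ entry bs i
entry-old {n} bs {i} i≤n rewrite dec-true (i ≤? n) i≤n = refl

entry-new : ∀ {n} (bs : Vec (Fin 2) n) → entry (zero ∷ bs) (suc n) ≡ level (suc n)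
entry-new {n} bs rewrite dec-false (suc n ≤? n) ℕ.1+n≰n = refl

rangeSum : (ℕ → ℚ) → ℕ → ℕ → ℚ
rangeSum a q m = sum {n = m} λ j → a (q ℕ.+ toℕ j)

rangeSum-split : ∀ a q m →
  rangeSum a q (suc m) ≡ a q ℚ.+ rangeSum a (suc q) m
rangeSum-split a q m = cong₂ ℚ._+_ (cong a (ℕ.+-identityʳ q))
  (sum-cong-≗ {n = m} λ j → cong a (ℕ.+-suc q (toℕ j)))

rangeSum-splitʳ : ∀ a q m →
  rangeSum a q (suc m) ≡ rangeSum a q m ℚ.+ a (q ℕ.+ m)
rangeSum-splitʳ a q m = trans
  (sum-init-last {n = m} λ j → a (q ℕ.+ toℕ j))
  (cong₂ ℚ._+_
    (sum-cong-≗ {n = m} λ j → cong (λ k → a (q ℕ.+ k)) (Fin.toℕ-inject₁ j))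
    (cong (λ k → a (q ℕ.+ k)) (Fin.toℕ-fromℕ m)))

-- Neighbouring windows share the `m` entries from `suc q` on, so only the two outer entries are
-- compared. The same holds for the slide to the left.
rangeSum-slideʳ : ∀ a q m → a q ℚ.< a (suc q ℕ.+ m) →
  rangeSum a q (suc m) ℚ.< rangeSum a (suc q) (suc m)
rangeSum-slideʳ a q m a< = subst₂ ℚ._<_
  (trans (ℚ.+-comm _ (a q)) (sym (rangeSum-split a q m)))
  (sym (rangeSum-splitʳ a (suc q) m))
  (ℚ.+-monoʳ-< (rangeSum a (suc q) m) a<)

rangeSum-slideˡ : ∀ a q m → a (suc q ℕ.+ m) ℚ.< a q →
  rangeSum a (suc q) (suc m) ℚ.< rangeSum a q (suc m)
rangeSum-slideˡ a q m a< = subst₂ ℚ._<_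
  (sym (rangeSum-splitʳ a (suc q) m))
  (trans (ℚ.+-comm _ (a q)) (sym (rangeSum-split a q m)))
  (ℚ.+-monoʳ-< (rangeSum a (suc q) m) a<)

-- The window ends at `q + ℓ`, at most `k + ℓ`, just short of the appended entry.
rangeSum-old : ∀ k ℓ (bs : Vec (Fin 2) (k ℕ.+ ℓ)) {q} → q ℕ.≤ k →
  rangeSum (entry (zero ∷ bs)) q (suc ℓ) ≡ rangeSum (entry bs) q (suc ℓ)
rangeSum-old k ℓ bs q≤k = sum-cong-≗ {n = suc ℓ} λ j →
  entry-old bs (ℕ.+-mono-≤ q≤k (Fin.toℕ≤pred[n] j))

-- The optimal start for the window length n + 1 ∸ k, which has k + 1 windows.
start : ∀ {n} → Vec (Fin 2) n → ℕ → ℕ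
start _        zero    = 0
start []       (suc k) = 0
start (b ∷ bs) (suc k) = toℕ b ℕ.+ start bs k

start≤ : ∀ {n} (bs : Vec (Fin 2) n) k → start bs k ℕ.≤ k
start≤ bs       zero    = z≤n
start≤ []       (suc k) = z≤n
start≤ (b ∷ bs) (suc k) = ℕ.+-mono-≤ (Fin.toℕ≤pred[n] b) (start≤ bs k)

-- The start at `1` is the head bit; cancelling it from the later starts leaves those of the tail.
start-injective : ∀ {n} (bs cs : Vec (Fin 2) n) →
  (∀ {k} → k ℕ.≤ n → start bs k ≡ start cs k) → bs ≡ cs
start-injective []       []       eq = refl
start-injective (b ∷ bs) (c ∷ cs) eq
  with refl ← Fin.toℕ-injective (ℕ.+-cancelʳ-≡ 0 (toℕ b) (toℕ c) (eq (s≤s z≤n)))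
  = cong (b ∷_) (start-injective bs cs λ k≤n → ℕ.+-cancelˡ-≡ (toℕ b) _ _ (eq (s≤s k≤n)))

-- The strict form calls this weak form on the shorter sequence, where the window reached by sliding
-- may already be the optimal one.
start-maximum : ∀ k ℓ {n} (bs : Vec (Fin 2) n) → k ℕ.+ ℓ ≡ n → ∀ {q} → q ℕ.≤ k →
  rangeSum (entry bs) q (suc ℓ) ℚ.≤ rangeSum (entry bs) (start bs k) (suc ℓ)

-- Induction on `k`, undoing the last insertion. Windows that avoid the newest entry are windows of
-- the shorter sequence; the single one that contains it loses to its neighbour. For `k = 0` the
-- only window is the whole sequence.
start-strict-maximum : ∀ k ℓ {n} (bs : Vec (Fin 2) n) → k ℕ.+ ℓ ≡ n → ∀ {q} → q ℕ.≤ k →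
  q ≢ start bs k →
  rangeSum (entry bs) q (suc ℓ) ℚ.< rangeSum (entry bs) (start bs k) (suc ℓ)

start-maximum k ℓ bs eq {q} q≤k with q ℕ.≟ start bs k
... | yes q≡ = ℚ.≤-reflexive (cong (λ p → rangeSum (entry bs) p (suc ℓ)) q≡)
... | no  q≢ = ℚ.<⇒≤ (start-strict-maximum k ℓ bs eq q≤k q≢)

start-strict-maximum zero ℓ bs eq z≤n q≢ = contradiction refl q≢
start-strict-maximum (suc k) ℓ (zero ∷ bs) refl {q} q≤ q≢ with q ≤? k
... | yes q≤k = subst₂ ℚ._<_
  (sym (rangeSum-old k ℓ bs q≤k)) (sym (rangeSum-old k ℓ bs (start≤ bs k)))
  (start-strict-maximum k ℓ bs refl q≤k q≢)
-- Now `q = suc k`, the window that ends at the appended entry. Sliding left trades that entry for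
-- the one at `k`.
... | no  q≰k with refl ← ℕ.≤-antisym q≤ (ℕ.≰⇒> q≰k) = ℚ.<-≤-trans
  (rangeSum-slideˡ (entry (zero ∷ bs)) k ℓ (subst₂ ℚ._<_
    (sym (entry-new bs)) (sym (entry-old bs (ℕ.m≤m+n k ℓ))) (level<entry bs k)))
  (subst₂ ℚ._≤_
    (sym (rangeSum-old k ℓ bs ℕ.≤-refl)) (sym (rangeSum-old k ℓ bs (start≤ bs k)))
    (start-maximum k ℓ bs refl ℕ.≤-refl))
-- Sliding right drops the prepended entry. A window from `suc q` reduces definitionally to the old
-- window from `q`, so the induction applies without conversion.
start-strict-maximum (suc k) ℓ (suc zero ∷ bs) refl {zero} q≤ q≢ = ℚ.<-≤-trans
  (rangeSum-slideʳ (entry (suc zero ∷ bs)) 0 ℓ (level<entry bs ℓ))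
  (start-maximum k ℓ bs refl z≤n)
start-strict-maximum (suc k) ℓ (suc zero ∷ bs) refl {suc q} (s≤s q≤k) q≢ =
  start-strict-maximum k ℓ bs refl q≤k (q≢ ∘ cong suc)

-- Constancy is assumed termwise because window sums are built with `_+ℝ_`, whose Cauchy proof
-- differs from that of `fromℚ`.
constant-mono-≤ : ∀ x y {p q} → (∀ n → seq x n ≡ p) → (∀ n → seq y n ≡ q) →
  p ℚ.≤ q → x ≤ℝ y
constant-mono-≤ x y {p} {q} x≡p y≡q p≤q ε 0<ε = 0 , λ n _ →
  subst₂ (λ u v → u ℚ.≤ v ℚ.+ ε) (sym (x≡p n)) (sym (y≡q n))
    (subst (ℚ._≤ q ℚ.+ ε) (ℚ.+-identityʳ p) (ℚ.+-mono-≤ p≤q (ℚ.<⇒≤ 0<ε)))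

constant-cancel-≤ : ∀ x y {p q} → (∀ n → seq x n ≡ p) → (∀ n → seq y n ≡ q) →
  x ≤ℝ y → p ℚ.≤ q
constant-cancel-≤ x y {p} {q} x≡p y≡q x≤y = ℚ.≮⇒≥ λ q<p →
  -- For `m` strictly between `q` and `p`, the tolerance `m - q` would force `p ≤ m`.
  let m , q<m , m<p = ℚ.<-dense q<p
      N , below     = x≤y (m ℚ.- q) (subst (ℚ._< m ℚ.- q) (ℚ.+-inverseʳ q)
                        (ℚ.+-monoˡ-< (ℚ.- q) q<m))
      p≤            = subst₂ (λ u v → u ℚ.≤ v ℚ.+ (m ℚ.- q)) (x≡p N) (y≡q N)
                        (below N ℕ.≤-refl)
      q+[m-q]≡m     = trans (cong (q ℚ.+_) (ℚ.+-comm m (ℚ.- q)))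
                        (trans (sym (ℚ.+-assoc q (ℚ.- q) m))
                        (trans (cong (ℚ._+ m) (ℚ.+-inverseʳ q)) (ℚ.+-identityˡ m)))
  in ℚ.<-irrefl refl (ℚ.<-≤-trans m<p (subst (p ℚ.≤_) q+[m-q]≡m p≤))

seq-sum : ∀ {m} (f : Vector ℝ m) k → seq (foldr _+ℝ_ 0ℝ f) k ≡ sum (λ j → seq (f j) k)
seq-sum {zero}  f k = refl
seq-sum {suc m} f k = cong (seq (f zero) k ℚ.+_) (seq-sum (f ∘ suc) k)

toℕ-windowIndex : ∀ {n} (ℓ : Fin n) (q : Fin (n ∸ toℕ ℓ)) j →
  toℕ (windowIndex ℓ q j) ≡ toℕ q ℕ.+ toℕ j
toℕ-windowIndex ℓ q j = Fin.toℕ-fromℕ< (ℕ.≤-trans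
  (ℕ.+-monoʳ-≤ (suc (toℕ q)) (Fin.toℕ≤pred[n] j))
  (ℕ.m≤o∸n⇒m+n≤o (suc (toℕ q)) (ℕ.<⇒≤ (Fin.toℕ<n ℓ)) (Fin.toℕ<n q)))

windowSum-rangeSum : ∀ {n} (a : ℕ → ℚ) (ℓ : Fin n) (q : Fin (n ∸ toℕ ℓ)) k →
  seq (windowSum (fromℚ ∘ a ∘ toℕ) ℓ q) k ≡ rangeSum a (toℕ q) (suc (toℕ ℓ))
windowSum-rangeSum a ℓ q k = trans
  (seq-sum (λ j → fromℚ (a (toℕ (windowIndex ℓ q j)))) k)
  (sum-cong-≗ {n = suc (toℕ ℓ)} λ j → cong a (toℕ-windowIndex ℓ q j))

module _ {n : ℕ} where

  suc-∸-toℕ : (ℓ : Fin (suc n)) → suc n ∸ toℕ ℓ ≡ suc (n ∸ toℕ ℓ)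
  suc-∸-toℕ ℓ = ℕ.+-∸-assoc 1 (Fin.toℕ≤pred[n] ℓ)

  start< : (bs : Vec (Fin 2) n) (ℓ : Fin (suc n)) →
    start bs (n ∸ toℕ ℓ) ℕ.< suc n ∸ toℕ ℓ
  start< bs ℓ = subst (start bs (n ∸ toℕ ℓ) ℕ.<_) (sym (suc-∸-toℕ ℓ))
    (s≤s (start≤ bs (n ∸ toℕ ℓ)))

  config : Vec (Fin 2) n → Config (suc n)
  config bs ℓ = fromℕ< (start< bs ℓ)

  toℕ-config : ∀ bs ℓ → toℕ (config bs ℓ) ≡ start bs (n ∸ toℕ ℓ)
  toℕ-config bs ℓ = Fin.toℕ-fromℕ< (start< bs ℓ)

  config-injective : ∀ bs cs → config bs ≈ config cs → bs ≡ cs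
  config-injective bs cs eq = start-injective bs cs λ {k} k≤n →
    -- The index `n ∸ k` stands for the window length whose optimal start is `start bs k`.
    let ℓ   = fromℕ< (s≤s (ℕ.m∸n≤m n k))
        n∸ℓ = trans (cong (n ∸_) (Fin.toℕ-fromℕ< (s≤s (ℕ.m∸n≤m n k)))) (ℕ.m∸[m∸n]≡n k≤n)
    in subst (λ j → start bs j ≡ start cs j) n∸ℓ
         (trans (sym (toℕ-config bs ℓ)) (trans (cong toℕ (eq ℓ)) (toℕ-config cs ℓ)))

  config-unique : ∀ bs → IsUnique (config bs)
  config-unique bs = A , isOutput , onlyOutput
    where
    A : Vector ℝ (suc n)
    A = fromℚ ∘ entry bs ∘ toℕ

    windowSum≡ : ∀ ℓ q k →
      seq (windowSum A ℓ q) k ≡ rangeSum (entry bs) (toℕ q) (suc (toℕ ℓ))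
    windowSum≡ = windowSum-rangeSum (entry bs)

    windowSum-config : ∀ ℓ k → seq (windowSum A ℓ (config bs ℓ)) k ≡
      rangeSum (entry bs) (start bs (n ∸ toℕ ℓ)) (suc (toℕ ℓ))
    windowSum-config ℓ k = trans (windowSum≡ ℓ (config bs ℓ) k)
      (cong (λ p → rangeSum (entry bs) p (suc (toℕ ℓ))) (toℕ-config bs ℓ))

    length-sum : (ℓ : Fin (suc n)) → n ∸ toℕ ℓ ℕ.+ toℕ ℓ ≡ n
    length-sum ℓ = ℕ.m∸n+n≡m (Fin.toℕ≤pred[n] ℓ)

    toℕ≤ : ∀ ℓ (q : Fin (suc n ∸ toℕ ℓ)) → toℕ q ℕ.≤ n ∸ toℕ ℓ
    toℕ≤ ℓ q = ℕ.≤-pred (subst (toℕ q ℕ.<_) (suc-∸-toℕ ℓ) (Fin.toℕ<n q))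

    isOutput : IsOutput A (config bs)
    isOutput ℓ q = constant-mono-≤ (windowSum A ℓ q) (windowSum A ℓ (config bs ℓ))
      (windowSum≡ ℓ q) (windowSum-config ℓ)
      (start-maximum (n ∸ toℕ ℓ) (toℕ ℓ) bs (length-sum ℓ) (toℕ≤ ℓ q))

    onlyOutput : ∀ Q → IsOutput A Q → Q ≈ config bs
    onlyOutput Q Q-output ℓ with toℕ (Q ℓ) ℕ.≟ start bs (n ∸ toℕ ℓ)
    ... | yes q≡ = Fin.toℕ-injective (trans q≡ (sym (toℕ-config bs ℓ)))
    -- Optimality of `Q` against `config bs` gives the reverse inequality between the rational sums.
    ... | no  q≢ = contradiction
      (ℚ.<-≤-trans
        (start-strict-maximum (n ∸ toℕ ℓ) (toℕ ℓ) bs (length-sum ℓ) (toℕ≤ ℓ (Q ℓ)) q≢)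
        (constant-cancel-≤ (windowSum A ℓ (config bs ℓ)) (windowSum A ℓ (Q ℓ))
          (windowSum-config ℓ) (windowSum≡ ℓ (Q ℓ)) (Q-output ℓ (config bs ℓ))))
      (ℚ.<-irrefl refl)

-- Binary digits, most significant first.
bits : ∀ n → Fin (2 ^ n) → Vec (Fin 2) n
bits zero    i = []
bits (suc n) i = quotient (2 ^ n) i ∷ bits n (remainder {2} (2 ^ n) i)

bits-injective : ∀ n {i j} → bits n i ≡ bits n j → i ≡ j
bits-injective zero    {zero} {zero} eq = refl
bits-injective (suc n) {i}    {j}    eq = begin
  i                                                         ≡⟨ Fin.combine-remQuot {2} (2 ^ n) i ⟨
  combine (quotient (2 ^ n) i) (remainder {2} (2 ^ n) i)    ≡⟨ cong₂ combine (∷-injectiveˡ eq) (bits-injective n (∷-injectiveʳ eq)) ⟩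
  combine (quotient (2 ^ n) j) (remainder {2} (2 ^ n) j)    ≡⟨ Fin.combine-remQuot {2} (2 ^ n) j ⟩
  j                                                         ∎
  where open ≡-Reasoning

-- Passing to unnormalised rationals avoids the gcd in `ℕ→ℚ` and leaves a cross-multiplication.
½*2m≡m : ∀ m → ½ ℚ.* ℕ→ℚ (2 ℕ.* m) ≡ ℕ→ℚ m
½*2m≡m m = ℚ.toℚᵘ-injective (begin
  toℚᵘ (½ ℚ.* ℕ→ℚ (2 ℕ.* m))             ≈⟨ ℚ.toℚᵘ-homo-* ½ (ℕ→ℚ (2 ℕ.* m)) ⟩
  toℚᵘ ½ ℚᵘ.* toℚᵘ (ℕ→ℚ (2 ℕ.* m))       ≈⟨ ℚᵘ.*-congˡ {toℚᵘ ½} (ℚ.toℚᵘ-fromℚᵘ (mkℚᵘ (+ (2 ℕ.* m)) 0)) ⟩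
  toℚᵘ ½ ℚᵘ.* mkℚᵘ (+ (2 ℕ.* m)) 0       ≈⟨ *≡* cross ⟩
  mkℚᵘ (+ m) 0                           ≈⟨ ℚ.toℚᵘ-fromℚᵘ (mkℚᵘ (+ m) 0) ⟨
  toℚᵘ (ℕ→ℚ m)                           ∎)
  where
  open ℚᵘ.≃-Reasoning

  cross : (+ 1 ℤ.* + (2 ℕ.* m)) ℤ.* + 1 ≡ + m ℤ.* + 2
  cross = trans (ℤ.*-identityʳ _) (trans (ℤ.*-identityˡ _)
    (trans (ℤ.pos-* 2 m) (ℤ.*-comm (+ 2) (+ m))))

theorem3 : Count IsUnique ∈Ω (λ n → 2 ^ n)
-- Length `suc n` has `n` insertions after the first value, hence `2 ^ n` configurations, half of
-- `2 ^ suc n`. The threshold `1` excludes length zero.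
theorem3 = ½ , from-yes (0ℚ ℚ.<? ½) , 1 , λ where
  (suc n) _ → 2 ^ n , ℚ.≤-reflexive (½*2m≡m (2 ^ n)) ,
    config ∘ bits n ,
    (λ eq → bits-injective n (config-injective _ _ eq)) ,
    (λ i → config-unique (bits n i))
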